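{- Let $d_nS=\{(M_1^0,M_1^1),\ldots,(M_n^0,M_n^1)\}$ be a special decomposition of the set $S$, and let $h(x_1,\ldots,x_n)$ be the Boolean function generated by this decomposition. Then there exists a special covering for the set $S$ under the decomposition $d_nS$ if and only if there exists a Boolean tuple $(\sigma_1,\ldots,\sigma_n)\in\{0,1\}^n$ such that $h(\sigma_1,\ldots,\sigma_n)=1$.
   Context: $S=\{e_1,\ldots,e_m\}$ is a nonempty ordered set of $m$ elements. Special decomposition. An ordered set $d_nS=\{(M_1^0,M_1^1),\ldots,(M_n^0,M_n^1)\}$ of ordered pairs of subsets of $S$ is a special decomposition of $S$ if (1) $M_i^0\cap M_i^1=\emptyset$ for all $i$; (2) for all $i$, $M_i^0\neq\emptyset$ or $M_i^1\neq\emptyset$; (3) $\bigcup_{i=1}^n(M_i^0\cup M_i^1)=S$. Special covering. For $(\alpha_1,\ldots,\alpha_n)\in\{0,1\}^n$, the ordered set $\{M_1^{\alpha_1},\ldots,M_n^{\alpha_n}\}$ is a special covering for $S$ under $d_nS$ if $\bigcup_{i=1}^n M_i^{\alpha_i}=S$. Function generated by a special decomposition. With $x_j^0=\bar x_j$, $x_j^1=x_j$, for each $e_i\in S$ put $l(e_i)=\{x_j^\alpha: e_i\in M_j^\alpha,\ j\in\{1,\ldots,n\},\ \alpha\in\{0,1\}\}$, let $c_i$ be the clause (disjunction) formed by the literals of $l(e_i)$, and let $h(x_1,\ldots,x_n)=\bigwedge_{i=1}^m c_i$. -}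

module Defs where

open import Data.Bool using (Bool; true; false; not)
open import Data.Fin using (Fin)
open import Data.Fin.Subset using (Subset; _∩_; _∪_; ⋃; ⊤; Empty; Nonempty)
open import Data.Fin.Subset.Properties using (_∈?_)
open import Data.List using (List; []; _∷_; map; filter; allFin; cartesianProduct; and; or)
open import Data.Nat using (ℕ)
open import Data.Product using (_×_; _,_; ∃-syntax; uncurry)
open import Data.Sum using (_⊎_)
open import Data.Vec as Vec using (Vec; lookup; tabulate; toList)
open import Relation.Binary.PropositionalEquality using (_≡_)

-- The ordered set S = {e₁, …, eₘ} is represented by Fin m, and S itself, as a
-- subset, is ⊤.  Elements of {0,1} are Booleans, with 0 = false and 1 = true.
-- Ordered sets of subsets, or of pairs of subsets, are vectors, so that
-- different positions may hold the same entry.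

component : ∀ {m} → Subset m × Subset m → Bool → Subset m
component (M⁰ , M¹) false = M⁰
component (M⁰ , M¹) true  = M¹

record SpecialDecomposition (m n : ℕ) : Set where
  field
    pairs : Vec (Subset m × Subset m) n

  -- M i α is Mᵢ^α.
  M : Fin n → Bool → Subset m
  M i = component (lookup pairs i)

  field
    disjoint : ∀ i → Empty (M i false ∩ M i true)
    nonempty : ∀ i → Nonempty (M i false) ⊎ Nonempty (M i true)
    covers   : ⋃ (toList (Vec.map (uncurry _∪_) pairs)) ≡ ⊤

module _ {m n : ℕ} (d : SpecialDecomposition m n) where
  open SpecialDecomposition d

  -- {M₁^α₁, …, Mₙ^αₙ}
  select : Vec Bool n → Vec (Subset m) n
  select α = tabulate λ i → M i (lookup α i)

  IsSpecialCovering : Vec (Subset m) n → Set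
  IsSpecialCovering C = ∃[ α ] (C ≡ select α × ⋃ (toList C) ≡ ⊤)

-- The pair (j , α) is the literal xⱼ^α.
Literal : ℕ → Set
Literal n = Fin n × Bool

-- x⁰ is the negation of x, and x¹ is x.
power : Bool → Bool → Bool
power x false = not x
power x true  = x

evalLiteral : ∀ {n} → Vec Bool n → Literal n → Bool
evalLiteral σ (j , α) = power (lookup σ j) α

evalClause : ∀ {n} → Vec Bool n → List (Literal n) → Bool
evalClause σ ls = or (map (evalLiteral σ) ls)

allLiterals : ∀ n → List (Literal n)
allLiterals n = cartesianProduct (allFin n) (false ∷ true ∷ [])

module _ {m n : ℕ} (d : SpecialDecomposition m n) where
  open SpecialDecomposition d

  -- l(eᵢ) = {xⱼ^α : eᵢ ∈ Mⱼ^α}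
  literals : Fin m → List (Literal n)
  literals i = filter (λ (j , α) → i ∈? M j α) (allLiterals n)

  generatedFunction : Vec Bool n → Bool
  generatedFunction σ = and (map (λ i → evalClause σ (literals i)) (allFin m))

{-# OPTIONS --safe #-}
-- Both sides hold for the same tuple: xⱼ^α takes the value 1 at σ exactly when
-- α = σⱼ, so the clause of eᵢ is true at σ iff eᵢ ∈ Mⱼ^σⱼ for some j, i.e. iff
-- eᵢ is covered by {M₁^σ₁, …, Mₙ^σₙ}.
module Submission where

open import Defs
open import Data.Bool using (Bool; true; false; T)
open import Data.Bool.Properties using (T-≡)
open import Data.Fin using (Fin)
open import Data.Fin.Subset using (Subset; _∈_; ⋃; ⊤)
open import Data.Fin.Subset.Properties using (_∈?_; ∈⊤; ∉⊥; ⊆⊤; ⊆-antisym; x∈p∪q⁺; x∈p∪q⁻)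
open import Data.List using (List; []; _∷_; allFin)
open import Data.List.Membership.Propositional using (find; lose) renaming (_∈_ to _∈ₗ_)
open import Data.List.Membership.Propositional.Properties
  using (∈-allFin; ∈-cartesianProduct⁺; ∈-filter⁺; ∈-filter⁻)
open import Data.List.Relation.Unary.All as All using ()
open import Data.List.Relation.Unary.All.Properties using (all⁺; all⁻)
open import Data.List.Relation.Unary.Any using (Any; here; there)
open import Data.List.Relation.Unary.Any.Properties using (any⁺; any⁻)
open import Data.Nat using (ℕ; NonZero)
open import Data.Product using (∃-syntax; _,_)
open import Data.Sum using (inj₁; inj₂)
open import Data.Vec using (Vec; lookup; toList)
open import Data.Vec.Relation.Unary.Any.Properties using (tabulate⁺; tabulate⁻; toList⁺; toList⁻)
open import Function.Bundles using (_⇔_; mk⇔; module Equivalence)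
open import Relation.Binary.PropositionalEquality using (_≡_; refl; subst; sym)

-- A tuple σ both selects one set from each pair and makes exactly one literal on each variable
-- true, and the two choices agree. So both sides of the theorem, at the same σ, reduce to the
-- pointwise condition `∀ i → Covered σ i`: `⋃-select⇔covered` does this for coverings, and
-- `generatedFunction⇔covered` does it for the conjunction, using `clause⇔covered` for each clause.

x∈⋃⁺ : ∀ {m} {x : Fin m} {ps : List (Subset m)} → Any (x ∈_) ps → x ∈ ⋃ ps
x∈⋃⁺ (here x∈p)   = x∈p∪q⁺ (inj₁ x∈p)
x∈⋃⁺ (there x∈ps) = x∈p∪q⁺ (inj₂ (x∈⋃⁺ x∈ps))

x∈⋃⁻ : ∀ {m} {x : Fin m} (ps : List (Subset m)) → x ∈ ⋃ ps → Any (x ∈_) ps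
x∈⋃⁻ []       x∈⊥ with () ← ∉⊥ x∈⊥
x∈⋃⁻ (p ∷ ps) x∈⋃ with x∈p∪q⁻ p (⋃ ps) x∈⋃
... | inj₁ x∈p  = here x∈p
... | inj₂ x∈ps = there (x∈⋃⁻ ps x∈ps)

T-power-refl : ∀ b → T (power b b)
T-power-refl false = _
T-power-refl true  = _

-- When `b` and `α` differ, `power b α` computes to `false`, so only the two agreeing cases remain.
T-power⇒≡ : ∀ b α → T (power b α) → α ≡ b
T-power⇒≡ false false _ = refl
T-power⇒≡ true  true  _ = refl

∈-bools : ∀ b → b ∈ₗ false ∷ true ∷ []
∈-bools false = here refl
∈-bools true  = there (here refl)

module _ {m n : ℕ} (d : SpecialDecomposition m n) where
  open SpecialDecomposition d

  Covered : Vec Bool n → Fin m → Set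
  Covered σ i = ∃[ j ] i ∈ M j (lookup σ j)

  ⋃-select⇔covered : ∀ σ → ⋃ (toList (select d σ)) ≡ ⊤ ⇔ (∀ i → Covered σ i)
  ⋃-select⇔covered σ = mk⇔
    (λ ⋃≡⊤ i → tabulate⁻ (toList⁻ (x∈⋃⁻ _ (subst (i ∈_) (sym ⋃≡⊤) ∈⊤))))
    (λ cov → ⊆-antisym ⊆⊤ λ {i} _ →
      let j , i∈M = cov i in x∈⋃⁺ (toList⁺ (tabulate⁺ j i∈M)))

  -- A disjunction is true iff one of its literals is, and the literals of the clause of `i` record
  -- exactly which sets `M j α` contain `i`.
  clause⇔covered : ∀ σ i → T (evalClause σ (literals d i)) ⇔ Covered σ i
  clause⇔covered σ i = mk⇔ to from
    where
    i∈M? = λ ((j , α) : Literal n) → i ∈? M j α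

    to : T (evalClause σ (literals d i)) → Covered σ i
    to t with (j , α) , l∈ , tl ← find (any⁻ (evalLiteral σ) (literals d i) t)
         -- The filter gives `i ∈ M j α` for the literal's own exponent; truth of the literal at σ
         -- then identifies `α` with `lookup σ j`.
         with _ , i∈M ← ∈-filter⁻ i∈M? {xs = allLiterals n} l∈
         = j , subst (λ b → i ∈ M j b) (T-power⇒≡ (lookup σ j) α tl) i∈M

    from : Covered σ i → T (evalClause σ (literals d i))
    -- The true literal is `(j , lookup σ j)`, the one on variable `j` that σ satisfies.
    from (j , i∈M) = any⁺ (evalLiteral σ) (lose
      (∈-filter⁺ i∈M? (∈-cartesianProduct⁺ (∈-allFin j) (∈-bools (lookup σ j))) i∈M)
      (T-power-refl (lookup σ j)))

  generatedFunction⇔covered : ∀ σ → generatedFunction d σ ≡ true ⇔ (∀ i → Covered σ i)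
  generatedFunction⇔covered σ = mk⇔
    (λ h≡1 i → Equivalence.to (clause⇔covered σ i)
      -- `generatedFunction d σ` unfolds to `all clause (allFin m)`, so its truth is that of every
      -- clause.
      (All.lookup (all⁺ clause _ (Equivalence.from T-≡ h≡1)) (∈-allFin i)))
    (λ cov → Equivalence.to T-≡
      (all⁻ clause {xs = allFin m} (All.tabulate λ {i} _ → Equivalence.from (clause⇔covered σ i) (cov i))))
    where
    clause : Fin m → Bool
    clause i = evalClause σ (literals d i)

theorem2p5 : (m n : ℕ) → .{{_ : NonZero m}} → (d : SpecialDecomposition m n) →
    (∃[ C ] IsSpecialCovering d C) ⇔ (∃[ σ ] generatedFunction d σ ≡ true)
theorem2p5 m n d = mk⇔
  -- The exponents defining the covering serve unchanged as the satisfying tuple, and conversely.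
  (λ { (_ , σ , refl , ⋃≡⊤) → σ ,
    Equivalence.from (generatedFunction⇔covered d σ) (Equivalence.to (⋃-select⇔covered d σ) ⋃≡⊤) })
  (λ { (σ , h≡1) → select d σ , σ , refl ,
    Equivalence.from (⋃-select⇔covered d σ) (Equivalence.to (generatedFunction⇔covered d σ) h≡1) })
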